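{- Let $t$ be a positive integer. (a) If $t(t+1)$ is not of the form $3l(l+1)$ for any $l\in\mathbb{N}$, then the interval $[4t+1,\,2t(t+1)+1]$ contains an integer $n\equiv 1\pmod 4$ with $b_3^+(n)$ odd. (b) If $2t(2t+1)$ is not of the form $3l(l+1)$ for any $l\in\mathbb{N}$, then the interval $[8t+1,\,4t(2t+1)+1]$ contains an integer $n\equiv 1\pmod 4$ with $b_3^+(n)$ even. In particular, there are infinitely many integers $n\equiv 1\pmod 4$ for which $c_3^+(n)$ is even, and infinitely many integers $n\equiv 1\pmod 4$ for which $c_3^+(n)$ is odd.
   Context: Let $q=e^{2\pi i z}$ with $z$ in the upper half-plane, and $\eta(z)=q^{1/24}\prod_{n\ge1}(1-q^n)$. Define $g_3^+(z)=\left(\frac{\eta(3z)}{\eta(z)}\right)^{12}=\sum_{n\ge 1}b_3^+(n)q^n$ (so $b_3^+(n)=0$ for $n<1$). Define $j_3^+(z)=\left(\frac{\eta(z)}{\eta(3z)}\right)^{12}+12+3^6\left(\frac{\eta(3z)}{\eta(z)}\right)^{12}$ and let $c_3^+(n)$ be the coefficient of $q^n$ in its $q$-expansion. -}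

module Defs where

open import Data.Nat as ℕ using (ℕ; zero; suc; _∸_)
open import Data.Nat.Divisibility using (_∣?_)
open import Data.Integer as ℤ using (ℤ; +_; -_)
open import Data.Integer.Divisibility as ℤd using ()
open import Relation.Nullary using (¬_; yes; no)

Series : Set
Series = ℕ → ℤ

sumTo : ℕ → (ℕ → ℤ) → ℤ
sumTo zero    f = f zero
sumTo (suc n) f = sumTo n f ℤ.+ f (suc n)

_⊛_ : Series → Series → Series
(f ⊛ g) n = sumTo n (λ k → f k ℤ.* g (n ∸ k))

one : Series
one zero    = + 1
one (suc _) = + 0

_^ˢ_ : Series → ℕ → Series
f ^ˢ zero  = one
f ^ˢ suc k = f ⊛ (f ^ˢ k)

oneMinus : ℕ → Series
oneMinus m zero = + 1
oneMinus m (suc k) with suc k ℕ.≟ m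
... | yes _ = - (+ 1)
... | no  _ = + 0

-- (1 - q^m)^{-1} = Σ_{k ≥ 0} q^{m k}   (used for m ≥ 1)
geom : ℕ → Series
geom m k with m ∣? k
... | yes _ = + 1
... | no  _ = + 0

Fprod : ℕ → Series
Fprod zero    = one
Fprod (suc M) = Fprod M ⊛ ((oneMinus (3 ℕ.* suc M) ^ˢ 12) ⊛ (geom (suc M) ^ˢ 12))

Gprod : ℕ → Series
Gprod zero    = one
Gprod (suc M) = Gprod M ⊛ ((oneMinus (suc M) ^ˢ 12) ⊛ (geom (3 ℕ.* suc M) ^ˢ 12))

-- g_3^+ = (η(3z)/η(z))^12 = q ∏_{m≥1} (1-q^{3m})^12 / (1-q^m)^12 = Σ b_3^+(n) q^n.
-- The coefficient of q^k in the infinite product only depends on factors m ≤ k,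
-- so it equals the coefficient of q^k in the finite product up to M = k+1.
b3⁺ : ℕ → ℤ
b3⁺ zero    = + 0
b3⁺ (suc k) = Fprod (suc k) k

-- 1/g_3^+ = q^{-1} ∏_{m≥1} (1-q^m)^12/(1-q^{3m})^12 ; coefficient of q^n (n ≥ -1)
-- is the coefficient of q^{n+1} of the product.  invg n = coefficient of q^n, n ≥ 0.
invg : ℕ → ℤ
invg n = Gprod (suc n) (suc n)

-- j_3^+ = 1/g_3^+ + 12 + 3^6 g_3^+ ; c_3^+(n) for n ≥ 0 (c_3^+(-1) = 1 is not needed).
c3⁺ : ℕ → ℤ
c3⁺ zero    = invg zero ℤ.+ + 12 ℤ.+ + 729 ℤ.* b3⁺ zero
c3⁺ (suc n) = invg (suc n) ℤ.+ + 729 ℤ.* b3⁺ (suc n)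

Evenℤ : ℤ → Set
Evenℤ x = (+ 2) ℤd.∣ x

Oddℤ : ℤ → Set
Oddℤ x = ¬ Evenℤ x

{-# OPTIONS --safe #-}
module Submission where

-- Modulo 2 we have g₃⁺ ≡ q P(q⁴) with P = ∏ (1 - x^{3m})³ / (1 - x^m)³, so b₃⁺(4k+1) is odd iff the
-- coefficient of x^k in P is.  Gauss' identity gives ∏ (1 - x^m)³ ≡ θ(x) := Σ x^{l(l+1)/2} (mod 2),
-- hence θ(x) P(x) ≡ θ(x³).  At the exponent t(t+1)/2, which does not occur in θ(x³) by hypothesis,
-- this says that the coefficients of P at (t(t+1) - l(l+1))/2 for 0 ≤ l ≤ t add up to 0.  The one for
-- l = t is 1, so an odd number of the other t coefficients are odd: at least one, and, if t is even
-- (part (b) uses 2t in place of t), not all of them.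
-- Likewise 1/g₃⁺ ≡ q⁻¹ Q(q⁴), which makes c₃⁺(n) ≡ b₃⁺(n) for n ≡ 1 (mod 4).

open import Defs
open import Algebra using (CommutativeRing; CommutativeSemiring)
import Algebra.Properties.CommutativeSemiring.Exp as CommutativeExp
import Algebra.Properties.Semiring.Exp as Exp
import Algebra.Solver.Ring as Solver
open import Algebra.Solver.Ring.AlmostCommutativeRing
  using (fromCommutativeSemiring; _-Raw-AlmostCommutative⟶_)
open import Data.Integer as ℤ using (ℤ; -[1+_]; ∣_∣; _⊖_)
import Data.Integer.Properties as ℤₚ
open import Data.Maybe using (just; nothing)
open import Data.Nat using (ℕ; zero; suc; _+_; _*_; _∸_; _≤_; _<_; _%_; s≤s; z≤n; parity)
open import Data.Nat.Divisibility as ℕ∣ using (_∣_; _∣?_; divides)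
open import Data.Nat.DivMod using ([m+kn]%n≡m%n)
import Data.Nat.Properties as ℕₚ
import Data.Nat.Solver as ℕSolver
open import Data.Parity.Base using (Parity; 0ℙ; 1ℙ)
  renaming (_+_ to infixl 6 _⊕_; _*_ to infixl 7 _⊗_; _⁻¹ to _ᶜ)
import Data.Parity.Properties as ℙ
open import Data.Product using (_×_; ∃-syntax; _,_)
open import Level using (_⊔_)
open import Relation.Binary.Definitions using (WeaklyDecidable)
open import Relation.Binary.PropositionalEquality as ≡ using (_≡_; _≢_)
open import Relation.Binary.Structures using (IsEquivalence)
open import Relation.Nullary using (yes; no; contradiction)

-- Triangular numbers.

triangle : ℕ → ℕ
triangle zero    = 0
triangle (suc l) = suc l + triangle l

triangle-double : ∀ l → triangle l * 2 ≡ l * suc l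
triangle-double zero    = ≡.refl
triangle-double (suc l) = begin
  (suc l + triangle l) * 2      ≡⟨ ℕₚ.*-distribʳ-+ 2 (suc l) (triangle l) ⟩
  suc l * 2 + triangle l * 2    ≡⟨ ≡.cong (suc l * 2 +_) (triangle-double l) ⟩
  suc l * 2 + l * suc l         ≡⟨ solve 1 (λ l → (con 1 :+ l) :* con 2 :+ l :* (con 1 :+ l)
                                      := (con 1 :+ l) :* (con 1 :+ (con 1 :+ l))) ≡.refl l ⟩
  suc l * suc (suc l)           ∎
  where
  open ≡.≡-Reasoning
  open ℕSolver.+-*-Solver

-- The product form is the one in which the exponent of (y^(2m+1))^(m+1) arises in `W-theta`;
-- `triangle-even` does the same for (y^(2m+3))^(m+1).
triangle-odd : ∀ m → triangle (suc (m * 2)) ≡ suc (m * 2) * suc m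
triangle-odd m = ℕₚ.*-cancelʳ-≡ _ _ 2 (≡.trans (triangle-double (suc (m * 2)))
  (solve 1 (λ m → (con 1 :+ m :* con 2) :* (con 1 :+ (con 1 :+ m :* con 2))
                := (con 1 :+ m :* con 2) :* (con 1 :+ m) :* con 2) ≡.refl m))
  where open ℕSolver.+-*-Solver

triangle-even : ∀ m → triangle (suc m * 2) ≡ suc (suc m * 2) * suc m
triangle-even m = ℕₚ.*-cancelʳ-≡ _ _ 2 (≡.trans (triangle-double (suc m * 2))
  (solve 1 (λ m → let n = (con 1 :+ m) :* con 2 in
                  n :* (con 1 :+ n) := (con 1 :+ n) :* (con 1 :+ m) :* con 2) ≡.refl m))
  where open ℕSolver.+-*-Solver

-- Congruences in a commutative semiring of characteristic two.

module CharacteristicTwo {c ℓ} (R : CommutativeSemiring c ℓ)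
  (1+1≈0 : CommutativeSemiring._≈_ R
    (CommutativeSemiring._+_ R (CommutativeSemiring.1# R) (CommutativeSemiring.1# R)) (CommutativeSemiring.0# R)) where

  open CommutativeSemiring R renaming (_+_ to _⊞_; _*_ to _·_)
  open Exp semiring public using (_^_; ^-homo-*; ^-assocʳ; ^-congʳ; ^-congˡ)
  open CommutativeExp R public using (^-distrib-*)
  open import Relation.Binary.Reasoning.Setoid setoid

  -- The coefficients of the normal forms lie in 𝔽₂, so that the solver knows 1 + 1 ≈ 0.
  private
    𝔽₂⟶R : CommutativeRing.rawRing ℙ.+-*-commutativeRing -Raw-AlmostCommutative⟶ fromCommutativeSemiring R
    𝔽₂⟶R = record
      { ⟦_⟧    = ⟦_⟧
      ; +-homo = λ { 0ℙ q → sym (+-identityˡ ⟦ q ⟧) ; 1ℙ 0ℙ → sym (+-identityʳ 1#) ; 1ℙ 1ℙ → sym 1+1≈0 }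
      ; *-homo = λ { 0ℙ q → sym (zeroˡ ⟦ q ⟧) ; 1ℙ q → sym (*-identityˡ ⟦ q ⟧) }
      ; -‿homo = λ _ → refl
      ; 0-homo = refl
      ; 1-homo = refl
      }
      where
      ⟦_⟧ : Parity → Carrier
      ⟦ 0ℙ ⟧ = 0#
      ⟦ 1ℙ ⟧ = 1#

    open _-Raw-AlmostCommutative⟶_ 𝔽₂⟶R using (⟦_⟧)

    _coeff≟_ : WeaklyDecidable (λ p q → ⟦ p ⟧ ≈ ⟦ q ⟧)
    0ℙ coeff≟ 0ℙ = just refl
    1ℙ coeff≟ 1ℙ = just refl
    _  coeff≟ _  = nothing

  module 𝔽₂-Solver = Solver _ _ 𝔽₂⟶R _coeff≟_
  open 𝔽₂-Solver

  infix 4 _≈_[mod_]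
  -- Since 1 + 1 = 0, the difference of a and b is their sum, so a semiring suffices. The relation
  -- is symmetric with the same quotient, because adding z · h twice changes nothing.
  record _≈_[mod_] (a b z : Carrier) : Set (c ⊔ ℓ) where
    constructor _,_
    field
      quotient : Carrier
      property : a ≈ b ⊞ z · quotient

  mod-reflexive : ∀ {a b z} → a ≈ b → a ≈ b [mod z ]
  mod-reflexive {a} {b} {z} a≈b = 0# , trans a≈b (solve 2 (λ b z → b := b :+ z :* con 0ℙ) refl b z)

  mod-sym : ∀ {a b z} → a ≈ b [mod z ] → b ≈ a [mod z ]
  mod-sym {a} {b} {z} (h , p) = h , (begin
    b                      ≈⟨ solve 2 (λ b zh → b := (b :+ zh) :+ zh) refl b (z · h) ⟩
    (b ⊞ z · h) ⊞ z · h    ≈⟨ +-congʳ p ⟨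
    a ⊞ z · h              ∎)

  mod-trans : ∀ {a b c z} → a ≈ b [mod z ] → b ≈ c [mod z ] → a ≈ c [mod z ]
  mod-trans {a} {b} {c} {z} (h , p) (k , q) = k ⊞ h , (begin
    a                      ≈⟨ p ⟩
    b ⊞ z · h              ≈⟨ +-congʳ q ⟩
    (c ⊞ z · k) ⊞ z · h    ≈⟨ solve 4 (λ c z k h → (c :+ z :* k) :+ z :* h := c :+ z :* (k :+ h)) refl c z k h ⟩
    c ⊞ z · (k ⊞ h)        ∎)

  mod-* : ∀ {a b c d z} → a ≈ b [mod z ] → c ≈ d [mod z ] → a · c ≈ b · d [mod z ]
  mod-* {a} {b} {c} {d} {z} (h , p) (k , q) = h · c ⊞ b · k , (begin
    a · c                        ≈⟨ *-congʳ p ⟩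
    (b ⊞ z · h) · c              ≈⟨ distribʳ c b (z · h) ⟩
    b · c ⊞ z · h · c            ≈⟨ +-congʳ (*-congˡ q) ⟩
    b · (d ⊞ z · k) ⊞ z · h · c  ≈⟨ solve 6 (λ b c d z h k →
                                      b :* (d :+ z :* k) :+ z :* h :* c := b :* d :+ z :* (h :* c :+ b :* k))
                                    refl b c d z h k ⟩
    b · d ⊞ z · (h · c ⊞ b · k)  ∎)

  mod-^ : ∀ {a b z} n → a ≈ b [mod z ] → a ^ n ≈ b ^ n [mod z ]
  mod-^ zero    p = mod-reflexive refl
  mod-^ (suc n) p = mod-* p (mod-^ n p)

  mod-weaken : ∀ {a b z} w → a ≈ b [mod z · w ] → a ≈ b [mod z ]
  mod-weaken {a} {b} {z} w (h , p) = w · h , trans p (+-congˡ (*-assoc z w h))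

  mod-weaken-^ : ∀ {a b} y m n → a ≈ b [mod y ^ (m + n) ] → a ≈ b [mod y ^ m ]
  mod-weaken-^ y m n (h , p) = mod-weaken (y ^ n) (h , trans p (+-congˡ (*-congʳ (^-homo-* y m n))))

  -- Gauss' identity for triangular exponents, in finite form.

  module Gauss (y : Carrier) where

    factor : ℕ → Carrier
    factor k = 1# ⊞ y ^ k

    euler : ℕ → Carrier
    euler zero    = 1#
    euler (suc n) = euler n · factor (suc n)

    eulerOdd : ℕ → Carrier
    eulerOdd zero    = 1#
    eulerOdd (suc n) = eulerOdd n · factor (suc (n * 2))

    eulerEven : ℕ → Carrier
    eulerEven zero    = 1#
    eulerEven (suc n) = eulerEven n · factor (suc n * 2)

    theta : ℕ → Carrier
    theta zero    = 0#
    theta (suc n) = theta n ⊞ y ^ triangle n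

    -- W n z = Σ_{s ≤ n} z^s ∏_{k ≤ s} (1 + y^{2k-1}) ∏_{s < k ≤ n} (1 + y^{2k})
    W : ℕ → Carrier → Carrier
    W zero    z = 1#
    W (suc n) z = factor (suc n * 2) · W n z ⊞ eulerOdd (suc n) · z ^ suc n

    -- A difference equation linking z with z y², by induction on n. It serves to move the argument
    -- of `W` from y^(2n+1) to y^(2n+3).
    W-functional : ∀ n z → (1# ⊞ y · z) · W n (z · (y · y)) ≈ (1# ⊞ z) · W n z ⊞ eulerOdd (suc n) · z ^ suc n
    W-functional zero z = solve 2 (λ y z →
      (con 1ℙ :+ y :* z) :* con 1ℙ :=
      (con 1ℙ :+ z) :* con 1ℙ :+ con 1ℙ :* (con 1ℙ :+ y :* con 1ℙ) :* (z :* con 1ℙ)) refl y z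
    W-functional (suc n) z = begin
      (1# ⊞ y · z) · (factor (suc n * 2) · W n (z · (y · y)) ⊞ D · (z · (y · y)) ^ suc n)
        ≈⟨ *-congˡ (+-congˡ (*-congˡ power)) ⟩
      (1# ⊞ y · z) · (factor (suc n * 2) · W n (z · (y · y)) ⊞ D · (zⁿ⁺¹ · y²ⁿ⁺²))
        ≈⟨ solve 6 (λ y z w d v u →
             (con 1ℙ :+ y :* z) :* ((con 1ℙ :+ u) :* w :+ d :* (v :* u)) :=
             (con 1ℙ :+ u) :* ((con 1ℙ :+ y :* z) :* w) :+ (con 1ℙ :+ y :* z) :* (d :* (v :* u)))
           refl y z (W n (z · (y · y))) D zⁿ⁺¹ y²ⁿ⁺² ⟩
      factor (suc n * 2) · ((1# ⊞ y · z) · W n (z · (y · y))) ⊞ (1# ⊞ y · z) · (D · (zⁿ⁺¹ · y²ⁿ⁺²))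
        ≈⟨ +-congʳ (*-congˡ (W-functional n z)) ⟩
      factor (suc n * 2) · ((1# ⊞ z) · W n z ⊞ D · zⁿ⁺¹) ⊞ (1# ⊞ y · z) · (D · (zⁿ⁺¹ · y²ⁿ⁺²))
        -- The two terms d v u cancel. With u = y^(2n+2), the factor 1 + y u is the one that extends
        -- `eulerOdd (suc n)` to `eulerOdd (suc (suc n))`.
        ≈⟨ solve 6 (λ y z w d v u →
             (con 1ℙ :+ u) :* ((con 1ℙ :+ z) :* w :+ d :* v) :+ (con 1ℙ :+ y :* z) :* (d :* (v :* u)) :=
             (con 1ℙ :+ z) :* ((con 1ℙ :+ u) :* w :+ d :* v) :+ (d :* (con 1ℙ :+ y :* u)) :* (z :* v))
           refl y z (W n z) D zⁿ⁺¹ y²ⁿ⁺² ⟩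
      (1# ⊞ z) · W (suc n) z ⊞ eulerOdd (suc (suc n)) · z ^ suc (suc n) ∎
      where
      D zⁿ⁺¹ y²ⁿ⁺² : Carrier
      D     = eulerOdd (suc n)
      zⁿ⁺¹  = z ^ suc n
      y²ⁿ⁺² = y ^ (suc n * 2)
      power : (z · (y · y)) ^ suc n ≈ zⁿ⁺¹ · y²ⁿ⁺²
      power = begin
        (z · (y · y)) ^ suc n      ≈⟨ ^-distrib-* z (y · y) (suc n) ⟩
        zⁿ⁺¹ · (y · y) ^ suc n     ≈⟨ *-congˡ (^-congˡ (suc n) (*-congˡ (*-identityʳ y))) ⟨
        zⁿ⁺¹ · (y ^ 2) ^ suc n     ≈⟨ *-congˡ (^-assocʳ y 2 (suc n)) ⟩
        zⁿ⁺¹ · y ^ (2 * suc n)     ≡⟨ ≡.cong (λ k → zⁿ⁺¹ · y ^ k) (ℕₚ.*-comm 2 (suc n)) ⟩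
        zⁿ⁺¹ · y²ⁿ⁺²               ∎

    -- Induction on n through the functional equation at z = y^(2n+1). Its correction term and the
    -- last summand of `W (suc n)` carry the exponents (2n+1)(n+1) and (2n+3)(n+1), which are the
    -- next two triangular numbers.
    W-theta : ∀ n → W n (y ^ suc (n * 2)) ≈ eulerOdd n · theta (suc (n * 2))
    W-theta zero    = solve 0 (con 1ℙ := con 1ℙ :* (con 0ℙ :+ con 1ℙ)) refl
    W-theta (suc n) = begin
      factor (suc n * 2) · W n (y · (y · z)) ⊞ D′ · (y ^ suc (suc n * 2)) ^ suc n
        ≈⟨ +-cong step (*-congˡ (trans (^-assocʳ y (suc (suc n * 2)) (suc n))
                                       (^-congʳ y (≡.sym (triangle-even n))))) ⟩
      ((1# ⊞ z) · (eulerOdd n · θ) ⊞ D′ · y ^ triangle (suc (n * 2))) ⊞ D′ · y ^ triangle (suc n * 2)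
        ≈⟨ solve 5 (λ z d θ a b →
             ((con 1ℙ :+ z) :* (d :* θ) :+ d :* (con 1ℙ :+ z) :* a) :+ d :* (con 1ℙ :+ z) :* b :=
             d :* (con 1ℙ :+ z) :* ((θ :+ a) :+ b))
           refl z (eulerOdd n) θ (y ^ triangle (suc (n * 2))) (y ^ triangle (suc n * 2)) ⟩
      D′ · theta (suc (suc n * 2)) ∎
      where
      z θ D′ : Carrier
      z  = y ^ suc (n * 2)
      θ  = theta (suc (n * 2))
      D′ = eulerOdd (suc n)
      W-cong : ∀ n {a b} → a ≈ b → W n a ≈ W n b
      W-cong zero    p = refl
      W-cong (suc n) p = +-cong (*-congˡ (W-cong n p)) (*-congˡ (^-congˡ (suc n) p))
      step : factor (suc n * 2) · W n (y · (y · z)) ≈ (1# ⊞ z) · (eulerOdd n · θ) ⊞ D′ · y ^ triangle (suc (n * 2))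
      step = begin
        -- By computation `factor (suc n * 2)` is 1 + y z, because z = y^(2n+1); this is exactly the
        -- factor on the left of the functional equation.
        (1# ⊞ y · z) · W n (y · (y · z))
          ≈⟨ *-congˡ (W-cong n (solve 2 (λ y z → y :* (y :* z) := z :* (y :* y)) refl y z)) ⟩
        (1# ⊞ y · z) · W n (z · (y · y))    ≈⟨ W-functional n z ⟩
        (1# ⊞ z) · W n z ⊞ D′ · z ^ suc n   ≈⟨ +-cong (*-congˡ (W-theta n))
                                                      (*-congˡ (trans (^-assocʳ y (suc (n * 2)) (suc n))
                                                                      (^-congʳ y (≡.sym (triangle-odd n))))) ⟩
        (1# ⊞ z) · (eulerOdd n · θ) ⊞ D′ · y ^ triangle (suc (n * 2)) ∎

    -- Only the summand s = 0 is free of z, and it is the full product of the even factors.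
    W-mod : ∀ n z → W n z ≈ eulerEven n [mod z ]
    W-mod zero    z = mod-reflexive refl
    W-mod (suc n) z with W-mod n z
    ... | h , p = f · h ⊞ D · z ^ n , (begin
      f · W n z ⊞ D · z ^ suc n                 ≈⟨ +-congʳ (*-congˡ p) ⟩
      f · (eulerEven n ⊞ z · h) ⊞ D · z ^ suc n ≈⟨ solve 6 (λ f e z h d v →
        f :* (e :+ z :* h) :+ d :* (z :* v) := e :* f :+ z :* (f :* h :+ d :* v))
        refl f (eulerEven n) z h D (z ^ n) ⟩
      eulerEven n · f ⊞ z · (f · h ⊞ D · z ^ n) ∎)
      where
      f D : Carrier
      f = factor (suc n * 2)
      D = eulerOdd (suc n)

    -- Frobenius: squaring is additive in characteristic two. Hence the product over even indices is
    -- the square of the product over all indices.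
    factor-double : ∀ k → factor (k * 2) ≈ factor k · factor k
    factor-double k = begin
      1# ⊞ y ^ (k * 2)      ≈⟨ +-congˡ (^-assocʳ y k 2) ⟨
      1# ⊞ (y ^ k) ^ 2
        ≈⟨ solve 1 (λ u → con 1ℙ :+ u :* (u :* con 1ℙ) := (con 1ℙ :+ u) :* (con 1ℙ :+ u)) refl (y ^ k) ⟩
      factor k · factor k   ∎

    eulerEven-square : ∀ n → eulerEven n ≈ euler n · euler n
    eulerEven-square zero    = sym (*-identityˡ 1#)
    eulerEven-square (suc n) = begin
      eulerEven n · factor (suc n * 2)
        ≈⟨ *-cong (eulerEven-square n) (factor-double (suc n)) ⟩
      euler n · euler n · (factor (suc n) · factor (suc n))
        ≈⟨ solve 2 (λ e f → e :* e :* (f :* f) := e :* f :* (e :* f))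
                                                                     refl (euler n) (factor (suc n)) ⟩
      euler (suc n) · euler (suc n)                              ∎

    eulerOdd*eulerEven : ∀ n → eulerOdd n · eulerEven n ≈ euler (n * 2)
    eulerOdd*eulerEven zero    = *-identityˡ 1#
    eulerOdd*eulerEven (suc n) = begin
      eulerOdd n · f · (eulerEven n · g)  ≈⟨ solve 4 (λ d f e g → d :* f :* (e :* g) := d :* e :* f :* g)
                                              refl (eulerOdd n) f (eulerEven n) g ⟩
      eulerOdd n · eulerEven n · f · g    ≈⟨ *-congʳ (*-congʳ (eulerOdd*eulerEven n)) ⟩
      euler (n * 2) · f · g               ∎
      where
      f g : Carrier
      f = factor (suc (n * 2))
      g = factor (suc n * 2)

    -- Every factor of index above m is 1 modulo y^(m+1), so partial products can stand in for the
    -- infinite product.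
    euler-mod : ∀ m j → euler (j + m) ≈ euler m [mod y ^ suc m ]
    euler-mod m zero    = mod-reflexive refl
    euler-mod m (suc j) = mod-trans
      (mod-* (euler-mod m j) (y ^ j , +-congˡ (trans (^-congʳ y (≡.cong suc (ℕₚ.+-comm j m))) (^-homo-* y (suc m) j))))
      (mod-reflexive (*-identityʳ (euler m)))

    -- Shanks' finite form of Gauss' identity Σ y^{l(l+1)/2} = ∏ (1 - y^{2k}) / (1 - y^{2k-1});
    -- in characteristic two the right-hand side is ∏ (1 + y^k)³.
    theta≈euler³ : ∀ n g → euler n · g ≈ 1# → theta (suc (n * 2)) ≈ euler n ^ 3 [mod y ^ suc n ]
    theta≈euler³ n g inverse =
      -- Multiplication by g replaces division by E: θ = E θ g, then E is exchanged for
      -- `euler (n * 2)`, whose product with θ is congruent to E^4, and E^4 g = E^3.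
      mod-trans (mod-reflexive (sym cancel-left))
      (mod-trans
        (mod-* {c = g} (mod-trans (mod-* (mod-sym truncate) (mod-reflexive refl)) product) (mod-reflexive refl))
      (mod-reflexive cancel-right))
      where
      E θ : Carrier
      E = euler n
      θ = theta (suc (n * 2))
      truncate : euler (n * 2) ≈ E [mod y ^ suc n ]
      truncate = ≡.subst (λ k → euler k ≈ E [mod y ^ suc n ])
                   (≡.trans (≡.cong (n +_) (≡.sym (ℕₚ.+-identityʳ n))) (ℕₚ.*-comm 2 n))
                   (euler-mod n n)
      product : euler (n * 2) · θ ≈ E · E · (E · E) [mod y ^ suc n ]
      product = mod-trans (mod-reflexive (begin
        euler (n * 2) · θ               ≈⟨ *-congʳ (eulerOdd*eulerEven n) ⟨
        eulerOdd n · eulerEven n · θ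
          ≈⟨ solve 3 (λ d e t → d :* e :* t := e :* (d :* t)) refl (eulerOdd n) (eulerEven n) θ ⟩
        eulerEven n · (eulerOdd n · θ)  ≈⟨ *-cong (eulerEven-square n) (sym (W-theta n)) ⟩
        E · E · W n (y ^ suc (n * 2))   ∎))
        (mod-* (mod-reflexive refl)
          -- `W-mod` at z = y^(2n+1) is precise modulo y^(2n+1); as 2n+1 = (n+1) + n, this is more
          -- than the required modulus y^(n+1).
          (mod-trans (mod-weaken-^ y (suc n) n
             (≡.subst (λ k → W n (y ^ suc (n * 2)) ≈ eulerEven n [mod y ^ k ])
               (≡.cong suc (≡.trans (ℕₚ.*-comm n 2) (≡.cong (n +_) (ℕₚ.+-identityʳ n)))) (W-mod n (y ^ suc (n * 2)))))
             (mod-reflexive (eulerEven-square n))))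
      cancel-left : E · θ · g ≈ θ
      cancel-left = begin
        E · θ · g   ≈⟨ solve 3 (λ e t g → e :* t :* g := e :* g :* t) refl E θ g ⟩
        E · g · θ   ≈⟨ *-congʳ inverse ⟩
        1# · θ      ≈⟨ *-identityˡ θ ⟩
        θ           ∎
      cancel-right : E · E · (E · E) · g ≈ E ^ 3
      cancel-right = begin
        E · E · (E · E) · g
          ≈⟨ solve 2 (λ e g → e :* e :* (e :* e) :* g := e :* g :* (e :* (e :* (e :* con 1ℙ)))) refl E g ⟩
        E · g · E ^ 3         ≈⟨ *-congʳ inverse ⟩
        1# · E ^ 3            ≈⟨ *-identityˡ (E ^ 3) ⟩
        E ^ 3                 ∎

    -- Inverses of the partial products.

    module Inverse (γ : ℕ → Carrier) (γ-inverse : ∀ m → factor (suc m) · γ m ≈ 1#) where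

      eulerInv : ℕ → Carrier
      eulerInv zero    = 1#
      eulerInv (suc n) = eulerInv n · γ n

      euler*eulerInv : ∀ n → euler n · eulerInv n ≈ 1#
      euler*eulerInv zero    = *-identityˡ 1#
      euler*eulerInv (suc n) = begin
        euler n · factor (suc n) · (eulerInv n · γ n)
          ≈⟨ solve 4 (λ e f i g → e :* f :* (i :* g) := e :* i :* (f :* g))
                                                              refl (euler n) (factor (suc n)) (eulerInv n) (γ n) ⟩
        euler n · eulerInv n · (factor (suc n) · γ n)    ≈⟨ *-cong (euler*eulerInv n) (γ-inverse n) ⟩
        1# · 1#                                          ≈⟨ *-identityˡ 1# ⟩
        1#                                               ∎

      γ≈1 : ∀ n → γ n ≈ 1# [mod y ^ suc n ]
      γ≈1 n = γ n , (begin
        γ n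
          ≈⟨ solve 2 (λ u g → g := (con 1ℙ :+ u) :* g :+ u :* g) refl (y ^ suc n) (γ n) ⟩
        factor (suc n) · γ n ⊞ y ^ suc n · γ n           ≈⟨ +-congʳ (γ-inverse n) ⟩
        1# ⊞ y ^ suc n · γ n                             ∎)

      eulerInv-mod : ∀ m j → eulerInv (j + m) ≈ eulerInv m [mod y ^ suc m ]
      eulerInv-mod m zero    = mod-reflexive refl
      eulerInv-mod m (suc j) = mod-trans
        (mod-* (eulerInv-mod m j)
          (mod-weaken-^ y (suc m) j
            (≡.subst (λ k → γ (j + m) ≈ 1# [mod y ^ suc k ]) (ℕₚ.+-comm j m) (γ≈1 (j + m)))))
        (mod-reflexive (*-identityʳ (eulerInv m)))

-- Formal power series over the field with two elements.

module PowerSeries where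

  open import Algebra.Properties.CommutativeSemigroup ℙ.+-commutativeSemigroup using (interchange; x∙yz≈y∙xz)
  open import Algebra.Structures.Biased using (isCommutativeSemiringˡ)
  open ≡.≡-Reasoning

  Carrier : Set
  Carrier = ℕ → Parity

  tail : Carrier → Carrier
  tail f n = f (suc n)

  infixl 6 _⊞_
  infixl 7 _·_ _∙_
  infix 4 _≈_

  -- The product follows f · g = f 0 g + x (tail f · g), which suits induction on the index;
  -- `reduce-⊛` identifies it with the Cauchy product.
  _⊞_ _·_ : Carrier → Carrier → Carrier
  (f ⊞ g) n = f n ⊕ g n
  (f · g) zero    = f 0 ⊗ g 0
  (f · g) (suc n) = f 0 ⊗ g (suc n) ⊕ (tail f · g) n

  _∙_ : Parity → Carrier → Carrier
  (p ∙ f) n = p ⊗ f n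

  0# 1# x : Carrier
  0# _ = 0ℙ
  1# zero    = 1ℙ
  1# (suc _) = 0ℙ
  x zero    = 0ℙ
  x (suc n) = 1# n

  -- A record rather than a bare function type, so that f and g can be inferred from f ≈ g.
  record _≈_ (f g : Carrier) : Set where
    constructor coefficientwise
    field at : ∀ n → f n ≡ g n
  open _≈_ public

  ·-cong : ∀ {f f′ g g′} → (∀ n → f n ≡ f′ n) → (∀ n → g n ≡ g′ n) → ∀ n → (f · g) n ≡ (f′ · g′) n
  ·-cong p q zero    = ≡.cong₂ _⊗_ (p 0) (q 0)
  ·-cong p q (suc n) = ≡.cong₂ _⊕_ (≡.cong₂ _⊗_ (p 0) (q (suc n))) (·-cong (λ k → p (suc k)) q n)

  ·-distribʳ : ∀ h f g n → ((f ⊞ g) · h) n ≡ (f · h) n ⊕ (g · h) n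
  ·-distribʳ h f g zero    = ℙ.*-distribʳ-+ (h 0) (f 0) (g 0)
  ·-distribʳ h f g (suc n) = ≡.trans
    (≡.cong₂ _⊕_ (ℙ.*-distribʳ-+ (h (suc n)) (f 0) (g 0)) (·-distribʳ h (tail f) (tail g) n))
    (interchange (f 0 ⊗ h (suc n)) (g 0 ⊗ h (suc n)) ((tail f · h) n) ((tail g · h) n))

  ·-zeroˡ : ∀ f n → (0# · f) n ≡ 0ℙ
  ·-zeroˡ f zero    = ≡.refl
  ·-zeroˡ f (suc n) = ·-zeroˡ f n

  ·-identityˡ : ∀ f n → (1# · f) n ≡ f n
  ·-identityˡ f zero    = ≡.refl
  ·-identityˡ f (suc n) = ≡.trans (≡.cong (f (suc n) ⊕_) (·-zeroˡ f n)) (ℙ.+-identityʳ (f (suc n)))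

  ∙-assoc : ∀ p f g n → ((p ∙ f) · g) n ≡ p ⊗ (f · g) n
  ∙-assoc p f g zero    = ℙ.*-assoc p (f 0) (g 0)
  ∙-assoc p f g (suc n) = ≡.trans
    (≡.cong₂ _⊕_ (ℙ.*-assoc p (f 0) (g (suc n))) (∙-assoc p (tail f) g n))
    (≡.sym (ℙ.*-distribˡ-+ p (f 0 ⊗ g (suc n)) ((tail f · g) n)))

  ·-assoc : ∀ f g h n → ((f · g) · h) n ≡ (f · (g · h)) n
  ·-assoc f g h zero    = ℙ.*-assoc (f 0) (g 0) (h 0)
  ·-assoc f g h (suc n) = begin
    -- The tail of f · g is `(f 0 ∙ tail g) ⊞ (tail f · g)` by computation, which is how scalar
    -- multiples enter.
    f 0 ⊗ g 0 ⊗ h (suc n) ⊕ (((f 0 ∙ tail g) ⊞ (tail f · g)) · h) n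
      ≡⟨ ≡.cong₂ _⊕_ (ℙ.*-assoc (f 0) (g 0) (h (suc n))) (·-distribʳ h (f 0 ∙ tail g) (tail f · g) n) ⟩
    f 0 ⊗ (g 0 ⊗ h (suc n)) ⊕ (((f 0 ∙ tail g) · h) n ⊕ ((tail f · g) · h) n)
      ≡⟨ ≡.cong (f 0 ⊗ (g 0 ⊗ h (suc n)) ⊕_) (≡.cong₂ _⊕_ (∙-assoc (f 0) (tail g) h n) (·-assoc (tail f) g h n)) ⟩
    f 0 ⊗ (g 0 ⊗ h (suc n)) ⊕ (f 0 ⊗ (tail g · h) n ⊕ (tail f · (g · h)) n)
      ≡⟨ ℙ.+-assoc (f 0 ⊗ (g 0 ⊗ h (suc n))) _ _ ⟨
    f 0 ⊗ (g 0 ⊗ h (suc n)) ⊕ f 0 ⊗ (tail g · h) n ⊕ (tail f · (g · h)) n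
      ≡⟨ ≡.cong (_⊕ (tail f · (g · h)) n) (ℙ.*-distribˡ-+ (f 0) (g 0 ⊗ h (suc n)) ((tail g · h) n)) ⟨
    f 0 ⊗ (g 0 ⊗ h (suc n) ⊕ (tail g · h) n) ⊕ (tail f · (g · h)) n ∎

  -- The mirror image of the defining recursion, splitting off the constant term of the second
  -- factor. Commutativity and the squaring rules rest on it.
  ·-sucʳ : ∀ f g n → (f · g) (suc n) ≡ f (suc n) ⊗ g 0 ⊕ (f · tail g) n
  ·-sucʳ f g zero    = ℙ.+-comm (f 0 ⊗ g 1) (f 1 ⊗ g 0)
  ·-sucʳ f g (suc n) = ≡.trans
    (≡.cong (f 0 ⊗ g (suc (suc n)) ⊕_) (·-sucʳ (tail f) g n))
    (x∙yz≈y∙xz (f 0 ⊗ g (suc (suc n))) (f (suc (suc n)) ⊗ g 0) ((tail f · tail g) n))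

  ·-comm : ∀ f g n → (f · g) n ≡ (g · f) n
  ·-comm f g zero    = ℙ.*-comm (f 0) (g 0)
  ·-comm f g (suc n) = begin
    f 0 ⊗ g (suc n) ⊕ (tail f · g) n    ≡⟨ ≡.cong₂ _⊕_ (ℙ.*-comm (f 0) (g (suc n))) (·-comm (tail f) g n) ⟩
    g (suc n) ⊗ f 0 ⊕ (g · tail f) n    ≡⟨ ·-sucʳ g f n ⟨
    (g · f) (suc n)                     ∎

  -- Frobenius for series: f(x)² = f(x²).
  ·-square-even : ∀ f n → (f · f) (n * 2) ≡ f n
  ·-square-odd  : ∀ f n → (f · f) (suc (n * 2)) ≡ 0ℙ

  -- Writing f = f 0 + x tail f gives f² = (f 0)² + x² (tail f)², since the two cross terms cancel.
  ·-square-suc² : ∀ f n → (f · f) (suc (suc n)) ≡ (tail f · tail f) n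
  ·-square-suc² f n = begin
    f 0 ⊗ f (suc (suc n)) ⊕ (tail f · f) (suc n)
      ≡⟨ ≡.cong (f 0 ⊗ f (suc (suc n)) ⊕_) (·-sucʳ (tail f) f n) ⟩
    f 0 ⊗ f (suc (suc n)) ⊕ (f (suc (suc n)) ⊗ f 0 ⊕ (tail f · tail f) n)
      ≡⟨ ℙ.+-assoc (f 0 ⊗ f (suc (suc n))) _ _ ⟨
    f 0 ⊗ f (suc (suc n)) ⊕ f (suc (suc n)) ⊗ f 0 ⊕ (tail f · tail f) n
      ≡⟨ ≡.cong (λ p → p ⊕ f (suc (suc n)) ⊗ f 0 ⊕ (tail f · tail f) n) (ℙ.*-comm (f 0) (f (suc (suc n)))) ⟩
    f (suc (suc n)) ⊗ f 0 ⊕ f (suc (suc n)) ⊗ f 0 ⊕ (tail f · tail f) n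
      ≡⟨ ≡.cong (_⊕ (tail f · tail f) n) (ℙ.p+p≡0ℙ (f (suc (suc n)) ⊗ f 0)) ⟩
    (tail f · tail f) n ∎

  ·-square-even f zero    = ℙ.*-idem (f 0)
  ·-square-even f (suc n) = ≡.trans (·-square-suc² f (n * 2)) (·-square-even (tail f) n)

  ·-square-odd f zero    = ≡.trans (≡.cong (f 0 ⊗ f 1 ⊕_) (ℙ.*-comm (f 1) (f 0))) (ℙ.p+p≡0ℙ (f 0 ⊗ f 1))
  ·-square-odd f (suc n) = ≡.trans (·-square-suc² f (suc (n * 2))) (·-square-odd (tail f) n)

  𝔽₂⟦x⟧ : CommutativeSemiring _ _
  𝔽₂⟦x⟧ = record
    { Carrier = Carrier
    ; _≈_ = _≈_
    ; _+_ = _⊞_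
    ; _*_ = _·_
    ; 0#  = 0#
    ; 1#  = 1#
    ; isCommutativeSemiring = isCommutativeSemiringˡ record
      { +-isCommutativeMonoid = record
        { isMonoid = record
          { isSemigroup = record
            { isMagma = record
              { isEquivalence = isEquivalence
              ; ∙-cong = λ p q → coefficientwise λ n → ≡.cong₂ _⊕_ (at p n) (at q n)
              }
            ; assoc = λ f g h → coefficientwise λ n → ℙ.+-assoc (f n) (g n) (h n)
            }
          ; identity = (λ f → coefficientwise λ _ → ≡.refl) , (λ f → coefficientwise λ n → ℙ.+-identityʳ (f n))
          }
        ; comm = λ f g → coefficientwise λ n → ℙ.+-comm (f n) (g n)
        }
      ; *-isCommutativeMonoid = record
        { isMonoid = record
          { isSemigroup = record
            { isMagma = record
              { isEquivalence = isEquivalence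
              ; ∙-cong = λ p q → coefficientwise (·-cong (at p) (at q))
              }
            ; assoc = λ f g h → coefficientwise (·-assoc f g h)
            }
          ; identity = (λ f → coefficientwise (·-identityˡ f))
                     , (λ f → coefficientwise λ n → ≡.trans (·-comm f 1# n) (·-identityˡ f n))
          }
        ; comm = λ f g → coefficientwise (·-comm f g)
        }
      ; distribʳ = λ h f g → coefficientwise (·-distribʳ h f g)
      ; zeroˡ    = λ f → coefficientwise (·-zeroˡ f)
      }
    }
    where
    isEquivalence : IsEquivalence _≈_
    isEquivalence = record
      { refl  = coefficientwise λ _ → ≡.refl
      ; sym   = λ p → coefficientwise λ n → ≡.sym (at p n)
      ; trans = λ p q → coefficientwise λ n → ≡.trans (at p n) (at q n)
      }

  1+1≈0 : 1# ⊞ 1# ≈ 0#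
  1+1≈0 = coefficientwise λ { zero → ≡.refl ; (suc n) → ≡.refl }

  open CharacteristicTwo 𝔽₂⟦x⟧ 1+1≈0 public
  open CommutativeSemiring 𝔽₂⟦x⟧ public
    using (refl; sym; trans; setoid; *-cong; *-congˡ; *-congʳ; *-assoc; *-identityˡ; *-identityʳ; +-congˡ)

  -- Coefficients of monomial multiples and of fourth powers.

  x·-suc : ∀ f n → (x · f) (suc n) ≡ f n
  x·-suc f = ·-identityˡ f

  x^·-shift : ∀ m f n → (x ^ m · f) (m + n) ≡ f n
  x^·-shift zero    f n = ·-identityˡ f n
  x^·-shift (suc m) f n = begin
    (x · x ^ m · f) (suc m + n)      ≡⟨ at (*-assoc x (x ^ m) f) (suc m + n) ⟩
    (x · (x ^ m · f)) (suc m + n)    ≡⟨ x·-suc (x ^ m · f) (m + n) ⟩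
    (x ^ m · f) (m + n)              ≡⟨ x^·-shift m f n ⟩
    f n                              ∎

  x^·-below : ∀ m f {n} → n < m → (x ^ m · f) n ≡ 0ℙ
  x^·-below (suc m) f {zero}  _         = ≡.refl
  x^·-below (suc m) f {suc n} (s≤s n<m) = begin
    (x · x ^ m · f) (suc n)          ≡⟨ at (*-assoc x (x ^ m) f) (suc n) ⟩
    (x · (x ^ m · f)) (suc n)        ≡⟨ x·-suc (x ^ m · f) n ⟩
    (x ^ m · f) n                    ≡⟨ x^·-below m f n<m ⟩
    0ℙ                               ∎

  x^-same : ∀ m → (x ^ m) m ≡ 1ℙ
  x^-same zero    = ≡.refl
  x^-same (suc m) = ≡.trans (x·-suc (x ^ m) m) (x^-same m)

  x^-other : ∀ m n → n ≢ m → (x ^ m) n ≡ 0ℙ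
  x^-other zero    zero    n≢m = contradiction ≡.refl n≢m
  x^-other zero    (suc n) n≢m = ≡.refl
  x^-other (suc m) zero    n≢m = ≡.refl
  x^-other (suc m) (suc n) n≢m = ≡.trans (x·-suc (x ^ m) n) (x^-other m n (λ n≡m → n≢m (≡.cong suc n≡m)))

  mod-coefficient : ∀ {f g m n} → f ≈ g [mod x ^ m ] → n < m → f n ≡ g n
  mod-coefficient {f} {g} {m} {n} (h , p) n<m = begin
    f n                       ≡⟨ at p n ⟩
    g n ⊕ (x ^ m · h) n       ≡⟨ ≡.cong (g n ⊕_) (x^·-below m h n<m) ⟩
    g n ⊕ 0ℙ                  ≡⟨ ℙ.+-identityʳ (g n) ⟩
    g n                       ∎

  fourth-power : ∀ f → f ^ 4 ≈ (f · f) · (f · f)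
  fourth-power f = solve 1 (λ f → f :* (f :* (f :* (f :* con 1ℙ))) := (f :* f) :* (f :* f)) refl f
    where open 𝔽₂-Solver

  -- Frobenius applied twice: f(x)^4 = f(x^4).
  fourth-power-4n : ∀ f n → (f ^ 4) (n * 2 * 2) ≡ f n
  fourth-power-4n f n = begin
    (f ^ 4) (n * 2 * 2)                ≡⟨ at (fourth-power f) (n * 2 * 2) ⟩
    ((f · f) · (f · f)) (n * 2 * 2)    ≡⟨ ·-square-even (f · f) (n * 2) ⟩
    (f · f) (n * 2)                    ≡⟨ ·-square-even f n ⟩
    f n                                ∎

  fourth-power-4n+2 : ∀ f n → (f ^ 4) (suc (n * 2) * 2) ≡ 0ℙ
  fourth-power-4n+2 f n = begin
    (f ^ 4) (suc (n * 2) * 2)              ≡⟨ at (fourth-power f) (suc (n * 2) * 2) ⟩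
    ((f · f) · (f · f)) (suc (n * 2) * 2)  ≡⟨ ·-square-even (f · f) (suc (n * 2)) ⟩
    (f · f) (suc (n * 2))                  ≡⟨ ·-square-odd f n ⟩
    0ℙ                                     ∎

-- Parities of integers.

par : ℤ → Parity
par z = parity ∣ z ∣

par-⊖ : ∀ m n → par (m ⊖ n) ≡ parity m ⊕ parity n
par-⊖ m       zero    = ≡.sym (ℙ.+-identityʳ (parity m))
par-⊖ zero    (suc n) = ≡.refl
par-⊖ (suc m) (suc n) = begin
  par (suc m ⊖ suc n)                ≡⟨ ≡.cong par (ℤₚ.[1+m]⊖[1+n]≡m⊖n m n) ⟩
  par (m ⊖ n)                        ≡⟨ par-⊖ m n ⟩
  parity m ⊕ parity n                ≡⟨ ≡.cong₂ _⊕_ (ℙ.suc-homo-⁻¹ m) (ℙ.suc-homo-⁻¹ n) ⟨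
  (parity (suc m) ᶜ) ⊕ (parity (suc n) ᶜ) ≡⟨ complements (parity (suc m)) (parity (suc n)) ⟩
  parity (suc m) ⊕ parity (suc n)    ∎
  where
  open ≡.≡-Reasoning
  complements : ∀ p q → (p ᶜ) ⊕ (q ᶜ) ≡ p ⊕ q
  complements 0ℙ 0ℙ = ≡.refl
  complements 0ℙ 1ℙ = ≡.refl
  complements 1ℙ 0ℙ = ≡.refl
  complements 1ℙ 1ℙ = ≡.refl

par-+ : ∀ a b → par (a ℤ.+ b) ≡ par a ⊕ par b
par-+ (ℤ.+ m)      (ℤ.+ n)      = ℙ.+-homo-+ m n
par-+ (ℤ.+ m)      -[1+ n ]   = par-⊖ m (suc n)
par-+ -[1+ m ]   (ℤ.+ n)      = ≡.trans (par-⊖ n (suc m)) (ℙ.+-comm (parity n) (parity (suc m)))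
par-+ -[1+ m ]   -[1+ n ] =
  ≡.trans (≡.cong (λ k → parity (suc k)) (≡.sym (ℕₚ.+-suc m n))) (ℙ.+-homo-+ (suc m) (suc n))

par-* : ∀ a b → par (a ℤ.* b) ≡ par a ⊗ par b
par-* a b = ≡.trans (≡.cong parity (ℤₚ.abs-* a b)) (ℙ.*-homo-* ∣ a ∣ ∣ b ∣)

even⇒Evenℤ : ∀ z → par z ≡ 0ℙ → Evenℤ z
even⇒Evenℤ z = half ∣ z ∣
  where
  half : ∀ n → parity n ≡ 0ℙ → 2 ∣ n
  half zero          _ = divides 0 ≡.refl
  half (suc (suc n)) p with half n p
  ... | divides q n≡q*2 = divides (suc q) (≡.cong (λ k → suc (suc k)) n≡q*2)

odd⇒Oddℤ : ∀ z → par z ≡ 1ℙ → Oddℤ z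
odd⇒Oddℤ z odd (divides q eq)
  with () ← ≡.trans (≡.sym odd) (≡.trans (≡.cong parity eq) (≡.trans (ℙ.*-homo-* q 2) (ℙ.*-zeroʳ (parity q))))

-- Reduction of integer series modulo two.

sumTo-suc : ∀ n f → sumTo (suc n) f ≡ f 0 ℤ.+ sumTo n (λ k → f (suc k))
sumTo-suc zero    f = ≡.refl
sumTo-suc (suc n) f = ≡.trans (≡.cong (ℤ._+ f (suc (suc n))) (sumTo-suc n f)) (ℤₚ.+-assoc (f 0) _ _)

open PowerSeries

reduce : Series → Carrier
reduce f n = par (f n)

reduce-⊛ : ∀ f g → reduce (f ⊛ g) ≈ reduce f · reduce g
reduce-⊛ f g = coefficientwise (coefficient f)
  where
  open ≡.≡-Reasoning
  coefficient : ∀ f n → par ((f ⊛ g) n) ≡ (reduce f · reduce g) n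
  coefficient f zero    = par-* (f 0) (g 0)
  coefficient f (suc n) = begin
    -- Splitting off the first summand of the Cauchy sum matches the recursion of `_·_`; the
    -- remainder is the Cauchy product of the tail of f with g.
    par ((f ⊛ g) (suc n))                                         ≡⟨ ≡.cong par (sumTo-suc n _) ⟩
    par (f 0 ℤ.* g (suc n) ℤ.+ ((λ k → f (suc k)) ⊛ g) n)         ≡⟨ par-+ (f 0 ℤ.* g (suc n)) _ ⟩
    par (f 0 ℤ.* g (suc n)) ⊕ par (((λ k → f (suc k)) ⊛ g) n)
      ≡⟨ ≡.cong₂ _⊕_ (par-* (f 0) (g (suc n))) (coefficient (λ k → f (suc k)) n) ⟩
    (reduce f · reduce g) (suc n)                                 ∎

reduce-one : reduce one ≈ 1#
reduce-one = coefficientwise λ { zero → ≡.refl ; (suc n) → ≡.refl }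

reduce-^ : ∀ f {u} n → reduce f ≈ u → reduce (f ^ˢ n) ≈ u ^ n
reduce-^ f zero    p = reduce-one
reduce-^ f (suc n) p = trans (reduce-⊛ f (f ^ˢ n)) (*-cong p (reduce-^ f n p))

reduce-oneMinus : ∀ m → reduce (oneMinus (suc m)) ≈ 1# ⊞ x ^ suc m
reduce-oneMinus m = coefficientwise coefficient
  where
  coefficient : ∀ n → par (oneMinus (suc m) n) ≡ 1# n ⊕ (x ^ suc m) n
  coefficient zero    = ≡.refl
  coefficient (suc n) with suc n ℕₚ.≟ suc m
  ... | yes ≡.refl = ≡.sym (x^-same (suc m))
  ... | no  n≢m    = ≡.sym (x^-other (suc m) (suc n) n≢m)

-- The geometric series is periodic with period m+1, and x^(m+1) shifts it by one period. The two
-- copies cancel except in the first period, where only the constant term is nonzero.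
geom-inverse : ∀ m → (1# ⊞ x ^ suc m) · reduce (geom (suc m)) ≈ 1#
geom-inverse m = coefficientwise λ n → ≡.trans (·-distribʳ γ 1# (x ^ suc m) n)
  (≡.trans (≡.cong (_⊕ (x ^ suc m · γ) n) (·-identityˡ γ n)) (coefficient n))
  where
  open ≡.≡-Reasoning
  γ : Carrier
  γ = reduce (geom (suc m))
  γ-zero : γ 0 ≡ 1ℙ
  γ-zero with suc m ∣? 0
  ... | yes _   = ≡.refl
  ... | no  m∤0 = contradiction (divides 0 ≡.refl) m∤0
  γ-below : ∀ n → suc n < suc m → γ (suc n) ≡ 0ℙ
  γ-below n n<m with suc m ∣? suc n
  ... | yes m∣n = contradiction m∣n (ℕ∣.>⇒∤ n<m)
  ... | no  _   = ≡.refl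
  γ-periodic : ∀ n → γ (suc m + n) ≡ γ n
  γ-periodic n with suc m ∣? (suc m + n) | suc m ∣? n
  ... | yes _   | yes _   = ≡.refl
  ... | no  _   | no  _   = ≡.refl
  ... | yes m∣ₛ | no  m∤n = contradiction (ℕ∣.∣m+n∣m⇒∣n m∣ₛ ℕ∣.∣-refl) m∤n
  ... | no  m∤ₛ | yes m∣n = contradiction (ℕ∣.∣m∣n⇒∣m+n ℕ∣.∣-refl m∣n) m∤ₛ
  coefficient : ∀ n → γ n ⊕ (x ^ suc m · γ) n ≡ 1# n
  coefficient n with n ℕₚ.<? suc m
  coefficient zero    | yes n<m = ≡.trans (≡.cong₂ _⊕_ γ-zero (x^·-below (suc m) γ n<m)) ≡.refl
  coefficient (suc n) | yes n<m = ≡.cong₂ _⊕_ (γ-below n n<m) (x^·-below (suc m) γ n<m)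
  coefficient n       | no  n≮m with n ∸ suc m | ℕₚ.m+[n∸m]≡n (ℕₚ.≮⇒≥ n≮m)
  ... | r | ≡.refl = begin
    γ (suc m + r) ⊕ (x ^ suc m · γ) (suc m + r)   ≡⟨ ≡.cong₂ _⊕_ (γ-periodic r) (x^·-shift (suc m) γ r) ⟩
    γ r ⊕ γ r                                     ≡⟨ ℙ.p+p≡0ℙ (γ r) ⟩
    0ℙ                                            ∎

-- Eta quotients modulo two.

module X  = Gauss x
module X³ = Gauss (x ^ 3)

factor-x³ : ∀ m → X³.factor m ≈ 1# ⊞ x ^ (3 * m)
factor-x³ m = +-congˡ {1#} (^-assocʳ x 3 m)

module XInv  = X.Inverse  (λ m → reduce (geom (suc m))) geom-inverse
module X³Inv = X³.Inverse (λ m → reduce (geom (3 * suc m)))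
                          -- `geom-inverse` takes the predecessor of the exponent, and `3 * suc m`
                          -- computes to `suc (m + 2 * suc m)`.
                          (λ m → trans (*-congʳ (factor-x³ (suc m))) (geom-inverse (m + 2 * suc m)))

reduce-12th-powers : ∀ f a b {u v w} → reduce f ≈ u ^ 12 → reduce a ≈ v → reduce b ≈ w →
                     reduce (f ⊛ ((a ^ˢ 12) ⊛ (b ^ˢ 12))) ≈ (u · (v · w)) ^ 12
reduce-12th-powers f a b {u} {v} {w} p q r = begin
  reduce (f ⊛ ((a ^ˢ 12) ⊛ (b ^ˢ 12)))             ≈⟨ reduce-⊛ f ((a ^ˢ 12) ⊛ (b ^ˢ 12)) ⟩
  reduce f · reduce ((a ^ˢ 12) ⊛ (b ^ˢ 12))
    ≈⟨ *-cong p (trans (reduce-⊛ (a ^ˢ 12) (b ^ˢ 12)) (*-cong (reduce-^ a 12 q) (reduce-^ b 12 r))) ⟩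
  u ^ 12 · (v ^ 12 · w ^ 12)                       ≈⟨ *-congˡ (^-distrib-* v w 12) ⟨
  u ^ 12 · (v · w) ^ 12                            ≈⟨ ^-distrib-* u (v · w) 12 ⟨
  (u · (v · w)) ^ 12                               ∎
  where open import Relation.Binary.Reasoning.Setoid setoid

·-exchange : ∀ a b c d → (a · b) · (c · d) ≈ (a · c) · (b · d)
·-exchange = solve 4 (λ a b c d → (a :* b) :* (c :* d) := (a :* c) :* (b :* d)) refl
  where open 𝔽₂-Solver

1≈[1·1]^12 : 1# ≈ (1# · 1#) ^ 12
1≈[1·1]^12 = solve 0 (con 1ℙ := (con 1ℙ :* con 1ℙ) :^ 12) refl
  where open 𝔽₂-Solver

-- Partial products of ∏ (1 - x^(3m)) / (1 - x^m) and of its reciprocal, reduced modulo 2; `Fprod`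
-- and `Gprod` reduce to their twelfth powers. The series P is the limit of the cubes of the first.
etaQuotient etaQuotient⁻¹ : ℕ → Carrier
etaQuotient   M = X³.euler M · XInv.eulerInv M
etaQuotient⁻¹ M = X.euler M · X³Inv.eulerInv M

reduce-Fprod : ∀ M → reduce (Fprod M) ≈ etaQuotient M ^ 12
reduce-Fprod zero    = trans reduce-one 1≈[1·1]^12
reduce-Fprod (suc M) = trans
  (reduce-12th-powers (Fprod M) (oneMinus (3 * suc M)) (geom (suc M)) (reduce-Fprod M)
    (trans (reduce-oneMinus (M + 2 * suc M)) (sym (factor-x³ (suc M)))) refl)
  (^-congˡ 12 (·-exchange (X³.euler M) (XInv.eulerInv M) (X³.factor (suc M)) (reduce (geom (suc M)))))

reduce-Gprod : ∀ M → reduce (Gprod M) ≈ etaQuotient⁻¹ M ^ 12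
reduce-Gprod zero    = trans reduce-one 1≈[1·1]^12
reduce-Gprod (suc M) = trans
  (reduce-12th-powers (Gprod M) (oneMinus (suc M)) (geom (3 * suc M)) (reduce-Gprod M) (reduce-oneMinus M) refl)
  (^-congˡ 12 (·-exchange (X.euler M) (X³Inv.eulerInv M) (X.factor (suc M)) (reduce (geom (3 * suc M)))))

-- The index 4k+1 is written with two doublings, the shape that the two applications of Frobenius
-- require.
b3⁺-parity : ℕ → Parity
b3⁺-parity k = par (b3⁺ (suc (k * 2 * 2)))

-- As 12 = 3 * 4, the reduced product is the fourth power of a cube; the factor q of g₃⁺ shifts the
-- exponent 4k to 4k+1.
b3⁺-parity≡etaQuotient³ : ∀ k → b3⁺-parity k ≡ (etaQuotient (suc (k * 2 * 2)) ^ 3) k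
b3⁺-parity≡etaQuotient³ k =
  ≡.trans (at (trans (reduce-Fprod M) (sym (^-assocʳ (etaQuotient M) 3 4))) (k * 2 * 2))
                    (fourth-power-4n (etaQuotient M ^ 3) k)
  where
  M : ℕ
  M = suc (k * 2 * 2)

-- The pole q⁻¹ turns the index 4k+1 into the exponent 4k+2, which does not occur in a fourth power.
par-invg : ∀ k → par (invg (suc (k * 2 * 2))) ≡ 0ℙ
par-invg k = ≡.trans (at (trans (reduce-Gprod M) (sym (^-assocʳ (etaQuotient⁻¹ M) 3 4))) (suc (k * 2) * 2))
                     (fourth-power-4n+2 (etaQuotient⁻¹ M ^ 3) k)
  where
  M : ℕ
  M = suc (suc (k * 2 * 2))

par-c3⁺ : ∀ k → par (c3⁺ (suc (k * 2 * 2))) ≡ b3⁺-parity k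
par-c3⁺ k = begin
  par (invg n ℤ.+ ℤ.+ 729 ℤ.* b3⁺ n)         ≡⟨ par-+ (invg n) (ℤ.+ 729 ℤ.* b3⁺ n) ⟩
  -- The contribution of 1/g₃⁺ is even and 729 is odd, so only b₃⁺(n) remains.
  par (invg n) ⊕ par (ℤ.+ 729 ℤ.* b3⁺ n)     ≡⟨ ≡.cong₂ _⊕_ (par-invg k) (par-* (ℤ.+ 729) (b3⁺ n)) ⟩
  par (b3⁺ n)                              ∎
  where
  open ≡.≡-Reasoning
  n : ℕ
  n = suc (k * 2 * 2)

-- The congruence θ(x) P(x) ≡ θ(x³) for truncations.

mod-x³⇒mod-x : ∀ {f g} m → f ≈ g [mod (x ^ 3) ^ m ] → f ≈ g [mod x ^ m ]
mod-x³⇒mod-x {g = g} m (h , p) = mod-weaken-^ x m (2 * m) (h , trans p (+-congˡ {g} (*-congʳ (^-assocʳ x 3 m))))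

-- Both truncations agree with the one at k modulo x^(k+1). Each value of b₃⁺ comes with its own
-- truncation, and this brings them all to a common one.
etaQuotient³-stable : ∀ {k} M N → k ≤ M → k ≤ N → (etaQuotient M ^ 3) k ≡ (etaQuotient N ^ 3) k
etaQuotient³-stable {k} M N k≤M k≤N = ≡.trans (fromMinimal M k≤M) (≡.sym (fromMinimal N k≤N))
  where
  stable : ∀ j → (etaQuotient (j + k) ^ 3) k ≡ (etaQuotient k ^ 3) k
  stable j = mod-coefficient
    (mod-^ 3 (mod-* (mod-x³⇒mod-x (suc k) (X³.euler-mod k j)) (XInv.eulerInv-mod k j))) (ℕₚ.n<1+n k)
  fromMinimal : ∀ M → k ≤ M → (etaQuotient M ^ 3) k ≡ (etaQuotient k ^ 3) k
  fromMinimal M k≤M = ≡.trans (≡.cong (λ M → (etaQuotient M ^ 3) k) (≡.sym (ℕₚ.m∸n+n≡m k≤M))) (stable (M ∸ k))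

-- Gauss' identity in x turns theta into E^3, which cancels the cube of I = 1/E; what remains is
-- E₃^3, and Gauss' identity in x³ turns it back into theta.
theta·etaQuotient³ : ∀ N → X.theta (suc (N * 2)) · etaQuotient N ^ 3 ≈ X³.theta (suc (N * 2)) [mod x ^ suc N ]
theta·etaQuotient³ N =
  mod-trans (mod-* (X.theta≈euler³ N I (XInv.euler*eulerInv N)) (mod-reflexive refl))
  (mod-trans (mod-reflexive (begin
    E ^ 3 · (E₃ · I) ^ 3     ≈⟨ ^-distrib-* E (E₃ · I) 3 ⟨
    (E · (E₃ · I)) ^ 3       ≈⟨ ^-congˡ 3 (solve 3 (λ e f i → e :* (f :* i) := e :* i :* f) refl E E₃ I) ⟩
    (E · I · E₃) ^ 3         ≈⟨ ^-congˡ 3 (trans (*-congʳ (XInv.euler*eulerInv N)) (*-identityˡ E₃)) ⟩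
    E₃ ^ 3                   ∎))
  (mod-sym (mod-x³⇒mod-x (suc N) (X³.theta≈euler³ N (X³Inv.eulerInv N) (X³Inv.euler*eulerInv N)))))
  where
  open import Relation.Binary.Reasoning.Setoid setoid
  open 𝔽₂-Solver
  E E₃ I : Carrier
  E  = X.euler N
  E₃ = X³.euler N
  I  = XInv.eulerInv N

-- Finite sums of parities.

∑ : ℕ → (ℕ → Parity) → Parity
∑ zero    c = 0ℙ
∑ (suc n) c = ∑ n c ⊕ c n

∑-cong : ∀ n {c d} → (∀ l → l < n → c l ≡ d l) → ∑ n c ≡ ∑ n d
∑-cong zero    p = ≡.refl
∑-cong (suc n) p = ≡.cong₂ _⊕_ (∑-cong n (λ l l<n → p l (ℕₚ.m<n⇒m<1+n l<n))) (p n (ℕₚ.n<1+n n))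

∑-zero : ∀ n {c} → (∀ l → c l ≡ 0ℙ) → ∑ n c ≡ 0ℙ
∑-zero zero    p = ≡.refl
∑-zero (suc n) p = ≡.cong₂ _⊕_ (∑-zero n p) (p n)

∑-truncate : ∀ m j {c} → (∀ l → m ≤ l → c l ≡ 0ℙ) → ∑ (j + m) c ≡ ∑ m c
∑-truncate m zero        p = ≡.refl
∑-truncate m (suc j) {c} p =
  ≡.trans (≡.cong₂ _⊕_ (∑-truncate m j p) (p (j + m) (ℕₚ.m≤n+m m j))) (ℙ.+-identityʳ (∑ m c))

∑-complement : ∀ n c → ∑ n (λ l → c l ᶜ) ≡ ∑ n c ⊕ parity n
∑-complement zero    c = ≡.refl
∑-complement (suc n) c = begin
  ∑ n (λ l → c l ᶜ) ⊕ (c n ᶜ)          ≡⟨ ≡.cong (_⊕ (c n ᶜ)) (∑-complement n c) ⟩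
  ∑ n c ⊕ parity n ⊕ (c n ᶜ)           ≡⟨ ≡.cong (λ p → ∑ n c ⊕ p ⊕ (c n ᶜ)) (ℙ.suc-homo-⁻¹ n) ⟨
  ∑ n c ⊕ (parity (suc n) ᶜ) ⊕ (c n ᶜ) ≡⟨ table (∑ n c) (c n) (parity (suc n)) ⟩
  ∑ n c ⊕ c n ⊕ parity (suc n)         ∎
  where
  open ≡.≡-Reasoning
  table : ∀ p q r → p ⊕ (r ᶜ) ⊕ (q ᶜ) ≡ p ⊕ q ⊕ r
  table 0ℙ 0ℙ 0ℙ = ≡.refl
  table 0ℙ 0ℙ 1ℙ = ≡.refl
  table 0ℙ 1ℙ 0ℙ = ≡.refl
  table 0ℙ 1ℙ 1ℙ = ≡.refl
  table 1ℙ 0ℙ 0ℙ = ≡.refl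
  table 1ℙ 0ℙ 1ℙ = ≡.refl
  table 1ℙ 1ℙ 0ℙ = ≡.refl
  table 1ℙ 1ℙ 1ℙ = ≡.refl

∑≡1⇒∃odd : ∀ n c → ∑ n c ≡ 1ℙ → ∃[ l ] (l < n × c l ≡ 1ℙ)
∑≡1⇒∃odd (suc n) c p with c n in eq
... | 1ℙ = n , ℕₚ.n<1+n n , eq
... | 0ℙ with ∑≡1⇒∃odd n c (≡.trans (≡.sym (ℙ.+-identityʳ (∑ n c))) p)
...   | l , l<n , odd = l , ℕₚ.m<n⇒m<1+n l<n , odd

-- Complementing an even number of terms preserves their sum, so the complemented sequence has an
-- odd term.
∑≡1⇒∃even : ∀ n c → parity n ≡ 0ℙ → ∑ n c ≡ 1ℙ → ∃[ l ] (l < n × c l ≡ 0ℙ)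
∑≡1⇒∃even n c n-even p
  with ∑≡1⇒∃odd n (λ l → c l ᶜ) (≡.trans (∑-complement n c) (≡.cong₂ _⊕_ p n-even))
... | l , l<n , q = l , l<n , ≡.trans (≡.sym (ℙ.⁻¹-involutive (c l))) (≡.cong _ᶜ q)

-- Comparison of coefficients at a triangular exponent.

theta·-coefficient : ∀ y n f k → (Gauss.theta y n · f) k ≡ ∑ n (λ l → (y ^ triangle l · f) k)
theta·-coefficient y zero    f k = ·-zeroˡ f k
theta·-coefficient y (suc n) f k = ≡.trans (·-distribʳ f (Gauss.theta y n) (y ^ triangle n) k)
  (≡.cong (_⊕ (y ^ triangle n · f) k) (theta·-coefficient y n f k))

triangle-mono : ∀ {l m} → l ≤ m → triangle l ≤ triangle m
triangle-mono z≤n       = z≤n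
triangle-mono (s≤s l≤m) = ℕₚ.+-mono-≤ (s≤s l≤m) (triangle-mono l≤m)

m≤triangle : ∀ m → m ≤ triangle m
m≤triangle zero    = z≤n
m≤triangle (suc m) = ℕₚ.m≤m+n (suc m) (triangle m)

k≤1+k*2*2 : ∀ k → k ≤ suc (k * 2 * 2)
k≤1+k*2*2 k = ℕₚ.m≤n⇒m≤1+n (ℕₚ.≤-trans (ℕₚ.m≤m*n k 2) (ℕₚ.m≤m*n (k * 2) 2))

-- The coefficients at `triangle t` in θ(x) P(x) ≡ θ(x³) are compared: the right side vanishes there
-- by hypothesis, and on the left the term l = t is set apart.
∑-b3⁺-parity : ∀ t → (∀ l → triangle t ≢ 3 * triangle l) →
            ∑ t (λ l → b3⁺-parity (triangle t ∸ triangle l)) ≡ 1ℙ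
∑-b3⁺-parity t ≢3△ = p⊕1≡0⇒p≡1 (begin
  ∑ t (λ l → b3⁺-parity (N ∸ triangle l)) ⊕ 1ℙ
    -- The added 1ℙ is the term l = t: `b3⁺-parity 0` computes to 1ℙ, because b₃⁺(1) is odd.
    ≡⟨ ≡.cong₂ _⊕_ (∑-cong t (λ l l<t → ≡.sym (term l (ℕₚ.<⇒≤ l<t))))
                   (≡.trans (≡.cong b3⁺-parity (≡.sym (ℕₚ.n∸n≡0 N))) (≡.sym (term t ℕₚ.≤-refl))) ⟩
  ∑ (suc t) c
    -- For l > t the exponent `triangle l` exceeds N, so the sum extends to all N * 2 + 1 terms of
    -- the truncated theta.
    ≡⟨ ∑-truncate (suc t) (N * 2 ∸ t) (λ l t<l → x^·-below (triangle l) f (ℕₚ.<-≤-trans (triangle-< t) (triangle-mono t<l))) ⟨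
  ∑ (N * 2 ∸ t + suc t) c
    ≡⟨ ≡.cong (λ n → ∑ n c) (≡.trans (ℕₚ.+-suc (N * 2 ∸ t) t)
         (≡.cong suc (ℕₚ.m∸n+n≡m (ℕₚ.≤-trans (m≤triangle t) (ℕₚ.m≤m*n N 2))))) ⟩
  ∑ (suc (N * 2)) c
    ≡⟨ theta·-coefficient x (suc (N * 2)) f N ⟨
  (X.theta (suc (N * 2)) · f) N
    -- The congruence holds modulo x^(N+1), just enough to read off the coefficient at N.
    ≡⟨ mod-coefficient (theta·etaQuotient³ N) (ℕₚ.n<1+n N) ⟩
  X³.theta (suc (N * 2)) N
    ≡⟨ at (*-identityʳ (X³.theta (suc (N * 2)))) N ⟨
  (X³.theta (suc (N * 2)) · 1#) N
    ≡⟨ theta·-coefficient (x ^ 3) (suc (N * 2)) 1# N ⟩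
  ∑ (suc (N * 2)) (λ l → ((x ^ 3) ^ triangle l · 1#) N)
    ≡⟨ ∑-zero (suc (N * 2)) (λ l → ≡.trans (at (trans (*-identityʳ _) (^-assocʳ x 3 (triangle l))) N)
                                           (x^-other (3 * triangle l) N (≢3△ l))) ⟩
  0ℙ ∎)
  where
  open ≡.≡-Reasoning
  N : ℕ
  N = triangle t
  f : Carrier
  f = etaQuotient N ^ 3
  c : ℕ → Parity
  c l = (x ^ triangle l · f) N
  triangle-< : ∀ t → triangle t < triangle (suc t)
  triangle-< t = s≤s (ℕₚ.m≤n+m (triangle t) t)
  term : ∀ l → l ≤ t → c l ≡ b3⁺-parity (N ∸ triangle l)
  term l l≤t = begin
    (x ^ triangle l · f) N                  ≡⟨ ≡.cong (x ^ triangle l · f) (ℕₚ.m+[n∸m]≡n (triangle-mono l≤t)) ⟨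
    (x ^ triangle l · f) (triangle l + k)   ≡⟨ x^·-shift (triangle l) f k ⟩
    f k
      ≡⟨ etaQuotient³-stable N (suc (k * 2 * 2)) (ℕₚ.m∸n≤m N (triangle l)) (k≤1+k*2*2 k) ⟩
    (etaQuotient (suc (k * 2 * 2)) ^ 3) k   ≡⟨ b3⁺-parity≡etaQuotient³ k ⟨
    b3⁺-parity k             ∎
    where
    k : ℕ
    k = N ∸ triangle l
  p⊕1≡0⇒p≡1 : ∀ {p} → p ⊕ 1ℙ ≡ 0ℙ → p ≡ 1ℙ
  p⊕1≡0⇒p≡1 {1ℙ} _ = ≡.refl

-- Odd and even values in the prescribed intervals.

triangle≢3*triangle : ∀ t → (∀ l → t * (t + 1) ≢ 3 * l * (l + 1)) → ∀ l → triangle t ≢ 3 * triangle l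
triangle≢3*triangle t t≢ l eq = t≢ l (begin
  t * (t + 1)              ≡⟨ ≡.cong (t *_) (ℕₚ.+-comm t 1) ⟩
  t * suc t                ≡⟨ triangle-double t ⟨
  triangle t * 2           ≡⟨ ≡.cong (_* 2) eq ⟩
  3 * triangle l * 2       ≡⟨ ℕₚ.*-assoc 3 (triangle l) 2 ⟩
  3 * (triangle l * 2)     ≡⟨ ≡.cong (3 *_) (triangle-double l) ⟩
  3 * (l * suc l)          ≡⟨ ≡.cong (λ k → 3 * (l * k)) (ℕₚ.+-comm l 1) ⟨
  3 * (l * (l + 1))        ≡⟨ ℕₚ.*-assoc 3 l (l + 1) ⟨
  3 * l * (l + 1)          ∎)
  where open ≡.≡-Reasoning

-- The difference is smallest for l = t - 1, where it equals t; this yields the lower end 4t+1 of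
-- the interval.
triangle-∸ : ∀ {l t} → l < t → t ≤ triangle t ∸ triangle l
triangle-∸ {l} {suc t} (s≤s l≤t) =
  ≡.subst (_≤ triangle (suc t) ∸ triangle l) (ℕₚ.m+n∸n≡m (suc t) (triangle t))
    (ℕₚ.∸-monoʳ-≤ (triangle (suc t)) (triangle-mono l≤t))

odd-b3⁺ : ∀ t → (∀ l → t * (t + 1) ≢ 3 * l * (l + 1)) →
          ∃[ k ] (t ≤ k × k ≤ triangle t × b3⁺-parity k ≡ 1ℙ)
odd-b3⁺ t t≢ = locate (∑≡1⇒∃odd t c (∑-b3⁺-parity t (triangle≢3*triangle t t≢)))
  where
  c : ℕ → Parity
  c l = b3⁺-parity (triangle t ∸ triangle l)
  locate : ∃[ l ] (l < t × c l ≡ 1ℙ) → ∃[ k ] (t ≤ k × k ≤ triangle t × b3⁺-parity k ≡ 1ℙ)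
  locate (l , l<t , odd) = triangle t ∸ triangle l , triangle-∸ l<t , ℕₚ.m∸n≤m (triangle t) (triangle l) , odd

even-b3⁺ : ∀ t → (∀ l → 2 * t * (2 * t + 1) ≢ 3 * l * (l + 1)) →
           ∃[ k ] (2 * t ≤ k × k ≤ triangle (2 * t) × b3⁺-parity k ≡ 0ℙ)
even-b3⁺ t t≢ =
  -- `ℙ.*-homo-* 2 t` is the evenness of the number of terms: the parity of 2 is 0ℙ, which
  -- annihilates.
  locate (∑≡1⇒∃even (2 * t) c (ℙ.*-homo-* 2 t) (∑-b3⁺-parity (2 * t) (triangle≢3*triangle (2 * t) t≢)))
  where
  c : ℕ → Parity
  c l = b3⁺-parity (triangle (2 * t) ∸ triangle l)
  locate : ∃[ l ] (l < 2 * t × c l ≡ 0ℙ) → ∃[ k ] (2 * t ≤ k × k ≤ triangle (2 * t) × b3⁺-parity k ≡ 0ℙ)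
  locate (l , l<t , even) =
    triangle (2 * t) ∸ triangle l , triangle-∸ l<t , ℕₚ.m∸n≤m (triangle (2 * t)) (triangle l) , even

4k+1≡1+k*2*2 : ∀ k → 4 * k + 1 ≡ suc (k * 2 * 2)
4k+1≡1+k*2*2 = solve 1 (λ k → con 4 :* k :+ con 1 := con 1 :+ k :* con 2 :* con 2) ≡.refl
  where open ℕSolver.+-*-Solver

4k+1-lower : ∀ {t k} → t ≤ k → 4 * t + 1 ≤ suc (k * 2 * 2)
4k+1-lower {t} {k} t≤k = ≡.subst (4 * t + 1 ≤_) (4k+1≡1+k*2*2 k) (ℕₚ.+-monoˡ-≤ 1 (ℕₚ.*-monoʳ-≤ 4 t≤k))

4k+1-upper : ∀ t {k} → k ≤ triangle t → suc (k * 2 * 2) ≤ 2 * t * (t + 1) + 1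
4k+1-upper t {k} k≤ = ≡.subst (suc (k * 2 * 2) ≤_) (begin
  suc (triangle t * 2 * 2)   ≡⟨ ≡.cong (λ n → suc (n * 2)) (triangle-double t) ⟩
  suc (t * suc t * 2)
    ≡⟨ solve 1 (λ t → con 1 :+ t :* (con 1 :+ t) :* con 2 := con 2 :* t :* (t :+ con 1) :+ con 1) ≡.refl t ⟩
  2 * t * (t + 1) + 1        ∎)
  (s≤s (ℕₚ.*-monoˡ-≤ 2 (ℕₚ.*-monoˡ-≤ 2 k≤)))
  where
  open ≡.≡-Reasoning
  open ℕSolver.+-*-Solver

4k+1-residue : ∀ k → suc (k * 2 * 2) % 4 ≡ 1
4k+1-residue k = ≡.trans (≡.cong (λ n → suc n % 4) (ℕₚ.*-assoc k 2 2)) ([m+kn]%n≡m%n 1 k 4)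

-- Residues modulo 3 exclude all l at once. Any s ≡ 1 (mod 3) has s(s+1) ≡ 2, which supplies
-- infinitely many admissible t.
2+3q≢3l[l+1] : ∀ {m} q → m ≡ 2 + q * 3 → ∀ l → m ≢ 3 * l * (l + 1)
2+3q≢3l[l+1] {m} q m≡ l m≡′ = contradiction 2≡0 λ ()
  where
  open ≡.≡-Reasoning
  2≡0 : 2 ≡ 0
  2≡0 = begin
    2                          ≡⟨ [m+kn]%n≡m%n 2 q 3 ⟨
    (2 + q * 3) % 3            ≡⟨ ≡.cong (_% 3) (≡.trans (≡.sym m≡) m≡′) ⟩
    (3 * l * (l + 1)) % 3      ≡⟨ ≡.cong (_% 3) (≡.trans (ℕₚ.*-assoc 3 l (l + 1)) (ℕₚ.*-comm 3 (l * (l + 1)))) ⟩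
    (0 + l * (l + 1) * 3) % 3  ≡⟨ [m+kn]%n≡m%n 0 (l * (l + 1)) 3 ⟩
    0                          ∎

theorem3p2 : ((t : ℕ) → 1 ≤ t → ((l : ℕ) → t * (t + 1) ≢ 3 * l * (l + 1)) →
    ∃[ n ] (4 * t + 1 ≤ n × n ≤ 2 * t * (t + 1) + 1 × n % 4 ≡ 1 × Oddℤ (b3⁺ n)))
    × ((t : ℕ) → 1 ≤ t → ((l : ℕ) → 2 * t * (2 * t + 1) ≢ 3 * l * (l + 1)) →
    ∃[ n ] (8 * t + 1 ≤ n × n ≤ 4 * t * (2 * t + 1) + 1 × n % 4 ≡ 1 × Evenℤ (b3⁺ n)))
    × ((N : ℕ) → ∃[ n ] (N ≤ n × n % 4 ≡ 1 × Evenℤ (c3⁺ n)))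
    × ((N : ℕ) → ∃[ n ] (N ≤ n × n % 4 ≡ 1 × Oddℤ (c3⁺ n)))
theorem3p2 = partA , partB , evenC , oddC
  where
  open ℕSolver.+-*-Solver

  partA : (t : ℕ) → 1 ≤ t → ((l : ℕ) → t * (t + 1) ≢ 3 * l * (l + 1)) →
    ∃[ n ] (4 * t + 1 ≤ n × n ≤ 2 * t * (t + 1) + 1 × n % 4 ≡ 1 × Oddℤ (b3⁺ n))
  partA t _ t≢ = conclude (odd-b3⁺ t t≢)
    where
    conclude : ∃[ k ] (t ≤ k × k ≤ triangle t × b3⁺-parity k ≡ 1ℙ) → _
    conclude (k , t≤k , k≤ , odd) =
      suc (k * 2 * 2) , 4k+1-lower t≤k , 4k+1-upper t k≤ , 4k+1-residue k , odd⇒Oddℤ (b3⁺ (suc (k * 2 * 2))) odd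

  partB : (t : ℕ) → 1 ≤ t → ((l : ℕ) → 2 * t * (2 * t + 1) ≢ 3 * l * (l + 1)) →
    ∃[ n ] (8 * t + 1 ≤ n × n ≤ 4 * t * (2 * t + 1) + 1 × n % 4 ≡ 1 × Evenℤ (b3⁺ n))
  partB t _ t≢ = conclude (even-b3⁺ t t≢)
    where
    conclude : ∃[ k ] (2 * t ≤ k × k ≤ triangle (2 * t) × b3⁺-parity k ≡ 0ℙ) → _
    conclude (k , t≤k , k≤ , even) =
        suc (k * 2 * 2)
      -- The bounds are those of part (a) at 2t, up to reassociating products.
      , ≡.subst (λ m → m + 1 ≤ suc (k * 2 * 2)) (≡.sym (ℕₚ.*-assoc 4 2 t)) (4k+1-lower t≤k)
      , ≡.subst (λ m → suc (k * 2 * 2) ≤ m * (2 * t + 1) + 1) (≡.sym (ℕₚ.*-assoc 2 2 t)) (4k+1-upper (2 * t) k≤)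
      , 4k+1-residue k , even⇒Evenℤ (b3⁺ (suc (k * 2 * 2))) even

  evenC : (N : ℕ) → ∃[ n ] (N ≤ n × n % 4 ≡ 1 × Evenℤ (c3⁺ n))
  evenC N = conclude (even-b3⁺ t (2+3q≢3l[l+1] (6 + N * 18 + N * N * 12)
    (solve 1 (λ N → let m = con 2 :* (con 2 :+ N :* con 3) in
      m :* (m :+ con 1) := con 2 :+ (con 6 :+ N :* con 18 :+ N :* N :* con 12) :* con 3) ≡.refl N)))
    where
    t : ℕ
    -- Chosen so that 2t ≡ 1 (mod 3); moreover t ≥ N, which forces n ≥ N.
    t = 2 + N * 3
    conclude : ∃[ k ] (2 * t ≤ k × k ≤ triangle (2 * t) × b3⁺-parity k ≡ 0ℙ) → _
    conclude (k , t≤k , _ , even) =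
        suc (k * 2 * 2)
      , ℕₚ.≤-trans (ℕₚ.≤-trans (ℕₚ.m≤n⇒m≤o+n 2 (ℕₚ.m≤m*n N 3)) (ℕₚ.m≤n*m t 2)) (ℕₚ.≤-trans t≤k (k≤1+k*2*2 k))
      , 4k+1-residue k , even⇒Evenℤ (c3⁺ (suc (k * 2 * 2))) (≡.trans (par-c3⁺ k) even)

  oddC : (N : ℕ) → ∃[ n ] (N ≤ n × n % 4 ≡ 1 × Oddℤ (c3⁺ n))
  oddC N = conclude (odd-b3⁺ t (2+3q≢3l[l+1] (N * 3 + N * N * 3)
    (solve 1 (λ N → let m = con 1 :+ N :* con 3 in
      m :* (m :+ con 1) := con 2 :+ (N :* con 3 :+ N :* N :* con 3) :* con 3) ≡.refl N)))
    where
    t : ℕ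
    -- Here t itself is 1 modulo 3, and again t ≥ N.
    t = 1 + N * 3
    conclude : ∃[ k ] (t ≤ k × k ≤ triangle t × b3⁺-parity k ≡ 1ℙ) → _
    conclude (k , t≤k , _ , odd) =
        suc (k * 2 * 2)
      , ℕₚ.≤-trans (ℕₚ.m≤n⇒m≤o+n 1 (ℕₚ.m≤m*n N 3)) (ℕₚ.≤-trans t≤k (k≤1+k*2*2 k))
      , 4k+1-residue k , odd⇒Oddℤ (c3⁺ (suc (k * 2 * 2))) (≡.trans (par-c3⁺ k) odd)
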